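{- Let $s:\mathfrak{C}\to\{0,1\}^n\cup\{*\}$ be a $4$-certificate of the $n$-dimensional hypercube $\mathfrak{C}=\{0,1\}^n$ with no projectable dimensions and such that $P_s$ spans all dimensions. Then $n=3$ and $s$ is isomorphic, up to flipping all the edges in some subset of the dimensions, to one of the partial outmaps $s^{(a)},s^{(b)}$ of $\{0,1\}^3$ given by $$s^{(a)}(100)=101,\quad s^{(a)}(010)=110,\quad s^{(a)}(001)=011,\quad s^{(a)}(111)=000,$$ $$s^{(b)}(000)=010,\quad s^{(b)}(100)=101,\quad s^{(b)}(011)=111,\quad s^{(b)}(111)=000,$$ with value $*$ at all other vertices. That is, there are $r\in\{s^{(a)},s^{(b)}\}$, a permutation $\pi$ of the three coordinates (acting on bitstrings of length $3$), and $a,z\in\{0,1\}^3$ such that for every $u\in\{0,1\}^3$: $s(\pi(u)\oplus a)=\pi(r(u))\oplus z$ if $r(u)\ne *$, and $s(\pi(u)\oplus a)=*$ if $r(u)=*$.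
   Context: The hypercube $\mathfrak{C}=\{0,1\}^n$ has an edge between $u$ and $u\oplus e_i$ for each $u\in\mathfrak{C}$, $i\in[n]=\{1,\dots,n\}$; $\oplus$ is bitwise XOR. A unique sink orientation (USO) is an orientation of the edges such that every face (subcube) has exactly one sink; it is identified with its outmap $t:\mathfrak{C}\to\{0,1\}^n$, where $t(u)_i=1$ iff the edge between $u$ and $u\oplus e_i$ is oriented away from $u$. (Equivalently, $t:\mathfrak{C}\to\{0,1\}^n$ is a USO iff $(t(u)\oplus t(v))\wedge(u\oplus v)\ne0^n$ for all distinct $u,v$.) A partial outmap is a function $s:\mathfrak{C}\to\{0,1\}^n\cup\{*\}$; its set of known vertices is $P_s=\{u\mid s(u)\ne *\}$. It is completable if there is a USO $t$ of $\mathfrak{C}$ with $t(u)=s(u)$ for all $u\in P_s$, and non-completable otherwise. For $P\subseteq P_s$, $s_P$ is the partial outmap with $s_P(u)=s(u)$ for $u\in P$ and $s_P(u)=*$ for $u\notin P$. A $k$-certificate is a partial outmap $s$ with $|P_s|=k$ that is non-completable and such that $s_P$ is completable for every proper subset $P\subsetneq P_s$. A dimension $i\in[n]$ is projectable if $s(u)_i=s(v)_i$ for all $u,v\in P_s$. A dimension $i$ is spanned if there are $u,v\in P_s$ with $u_i\ne v_i$; $P_s$ spans all dimensions if every $i\in[n]$ is spanned. Two partial outmaps are isomorphic if one is obtained from the other by an automorphism of the hypercube (a coordinate permutation composed with a translation $u\mapsto u\oplus a$), with the outmap values permuted accordingly. Flipping all edges in a subset of the dimensions replaces $s(u)$ by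 $s(u)\oplus z$ at all $u\in P_s$, where $z$ is the indicator bitstring of that subset. -}

module Defs where

open import Data.Bool.Base using (Bool; true; false; not; _xor_; if_then_else_; T)
open import Data.Fin.Base using (Fin)
open import Data.Fin.Permutation using (Permutation′; _⟨$⟩ˡ_)
open import Data.Fin.Subset using (Subset; ⁅_⁆; _∈_; _∉_)
open import Data.Maybe as Maybe using (Maybe; just; nothing; Is-just)
open import Data.Nat.Base using (ℕ)
open import Data.Product.Base using (∃; _×_)
open import Data.Product using (∃!)
open import Data.Vec.Base using (Vec; []; _∷_; lookup; tabulate; zipWith)
open import Function.Base using (_∘_)
open import Function.Bundles using (_↔_)
open import Level using (0ℓ)
open import Relation.Binary.PropositionalEquality using (_≡_; _≢_)
open import Relation.Nullary using (¬_)
open import Relation.Unary using (Pred; _⊂_)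

private
  variable
    n : ℕ

pattern 𝟎 = false
pattern 𝟏 = true

Bits : ℕ → Set
Bits n = Vec Bool n

infixl 6 _⊕_
_⊕_ : Bits n → Bits n → Bits n
_⊕_ = zipWith _xor_

Outmap : ℕ → Set
Outmap n = Bits n → Bits n

-- An outmap describes an orientation when the two endpoints of every edge
-- agree on its direction: it leaves exactly one of them.
IsOrientation : Outmap n → Set
IsOrientation t = ∀ u i → lookup (t (u ⊕ ⁅ i ⁆)) i ≡ not (lookup (t u) i)

-- The face through v spanned by the dimensions in I.
Face : Subset n → Bits n → Pred (Bits n) 0ℓ
Face I v u = ∀ i → i ∉ I → lookup u i ≡ lookup v i

SinkOf : Outmap n → Subset n → Bits n → Pred (Bits n) 0ℓ
SinkOf t I v u = Face I v u × (∀ i → i ∈ I → lookup (t u) i ≡ 𝟎)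

record IsUSO (t : Outmap n) : Set where
  field
    isOrientation : IsOrientation t
    uniqueSink    : ∀ I v → ∃! _≡_ (SinkOf t I v)

-- The value * is represented by nothing.
PartialOutmap : ℕ → Set
PartialOutmap n = Bits n → Maybe (Bits n)

Known : PartialOutmap n → Pred (Bits n) 0ℓ
Known s u = Is-just (s u)

Completable : PartialOutmap n → Set
Completable s = ∃ λ t → IsUSO t × (∀ u x → s u ≡ just x → t u ≡ x)

restrict : PartialOutmap n → (Bits n → Bool) → PartialOutmap n
restrict s P u = if P u then s u else nothing

-- Is-just has at most one proof, so `size` counts known vertices.
record IsCertificate (k : ℕ) (s : PartialOutmap n) : Set where
  field
    size           : Fin k ↔ ∃ (Known s)
    nonCompletable : ¬ Completable s
    minimal        : ∀ (P : Bits n → Bool) → (T ∘ P) ⊂ Known s →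
                     Completable (restrict s P)

Projectable : PartialOutmap n → Fin n → Set
Projectable s i = ∀ u v x y → s u ≡ just x → s v ≡ just y → lookup x i ≡ lookup y i

Spanned : PartialOutmap n → Fin n → Set
Spanned s i = ∃ λ u → ∃ λ v → Known s u × Known s v × lookup u i ≢ lookup v i

-- The bit at coordinate i moves to coordinate π(i).
permute : Permutation′ n → Bits n → Bits n
permute π u = tabulate λ i → lookup u (π ⟨$⟩ˡ i)

-- The translation by a acts on the vertices only; z flips all the edges in a
-- set of dimensions and acts on the outmap values only.
IsomorphicUpToFlips : PartialOutmap n → PartialOutmap n → Set
IsomorphicUpToFlips r s = ∃ λ π → ∃ λ a → ∃ λ z →
  ∀ u → s (permute π u ⊕ a) ≡ Maybe.map (λ x → permute π x ⊕ z) (r u)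

sᵃ : PartialOutmap 3
sᵃ (𝟏 ∷ 𝟎 ∷ 𝟎 ∷ []) = just (𝟏 ∷ 𝟎 ∷ 𝟏 ∷ [])
sᵃ (𝟎 ∷ 𝟏 ∷ 𝟎 ∷ []) = just (𝟏 ∷ 𝟏 ∷ 𝟎 ∷ [])
sᵃ (𝟎 ∷ 𝟎 ∷ 𝟏 ∷ []) = just (𝟎 ∷ 𝟏 ∷ 𝟏 ∷ [])
sᵃ (𝟏 ∷ 𝟏 ∷ 𝟏 ∷ []) = just (𝟎 ∷ 𝟎 ∷ 𝟎 ∷ [])
sᵃ _ = nothing

sᵇ : PartialOutmap 3
sᵇ (𝟎 ∷ 𝟎 ∷ 𝟎 ∷ []) = just (𝟎 ∷ 𝟏 ∷ 𝟎 ∷ [])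
sᵇ (𝟏 ∷ 𝟎 ∷ 𝟎 ∷ []) = just (𝟏 ∷ 𝟎 ∷ 𝟏 ∷ [])
sᵇ (𝟎 ∷ 𝟏 ∷ 𝟏 ∷ []) = just (𝟏 ∷ 𝟏 ∷ 𝟏 ∷ [])
sᵇ (𝟏 ∷ 𝟏 ∷ 𝟏 ∷ []) = just (𝟎 ∷ 𝟎 ∷ 𝟎 ∷ [])
sᵇ _ = nothing

{-# OPTIONS --safe #-}

-- By Szabó and Welzl, t is a USO iff any two vertices u, v are separated: some
-- dimension i has u_i ≠ v_i and t(u)_i ≠ t(v)_i. Two USOs of the facets in
-- dimension i combine to a USO of the cube when all edges in dimension i have one
-- default direction, except over vertices where the two USOs agree.
--
-- Dimension i sorts the known points into four classes by (u_i, s(u)_i). With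
-- either default direction, each facet has to respect all points but those of
-- one class, and i no longer separates any points. If some class is empty, one of
-- the two directions leaves the remaining points pairwise separated; by induction
-- on n at most three pairwise separated points are always completable. So for a
-- 4-certificate every dimension has one point in each class and separates two
-- disjoint pairs, and no pair is separated by two dimensions, since otherwise a
-- facet problem would again be pairwise separated. Hence the dimensions correspond
-- to the three perfect matchings of the four points, n = 3, and the eight ways of
-- choosing the vertex and value partitions reduce to sᵃ (two) and sᵇ (six).

module Submission where

open import Defs
open import Data.Bool.Base using (Bool; not; _xor_; T)
import Data.Bool.Properties as Bool
open import Data.Fin.Base using (Fin; zero; suc; punchIn; punchOut)
open import Data.Fin.Patterns using (0F; 1F; 2F; 3F)
open import Data.Fin.Properties as Fin using (any?; all?; punchOut-injective; injective⇒≤)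
open import Data.Fin.Permutation as Perm using (Permutation; Permutation′; permutation; transpose; _∘ₚ_; lift₀; _⟨$⟩ʳ_; _⟨$⟩ˡ_; inverseˡ; inverseʳ; ↔⇒≡)
open import Data.Fin.Subset using (Subset; ⁅_⁆; _∈_; _∉_; inside; outside)
open import Data.Fin.Subset.Properties using (_∈?_; x∈⁅x⁆; x∈⁅y⁆⇒x≡y; drop-there)
open import Data.Maybe.Base as Maybe using (Maybe; just; nothing)
open import Data.Maybe using (Is-just)
open import Data.Maybe.Relation.Unary.Any using (just)
open import Data.Maybe.Properties using (just-injective)
open import Data.Nat.Base using (ℕ; zero; suc)
open import Data.Nat.Properties using (1+n≰n)
open import Data.Product.Base using (∃; Σ-syntax; _×_; _,_; proj₁; proj₂)
open import Data.Product using (∃!)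
open import Data.Sum.Base as Sum using (_⊎_; inj₁; inj₂; [_,_]′)
open import Data.Vec.Base as Vec using (Vec; []; _∷_; lookup; tabulate; updateAt; insertAt; removeAt; _[_]≔_; there)
open import Data.Vec.Properties using (lookup-zipWith; lookup-replicate; lookup∘tabulate; tabulate∘lookup; tabulate-cong; []=⇒lookup; lookup⇒[]=; lookup∘updateAt; lookup∘updateAt′; lookup∘update; lookup∘update′; insertAt-lookup; insertAt-punchIn; insertAt-removeAt; removeAt-punchOut; ≡-dec)
import Data.Product.Properties as Product
open import Data.Product.Function.NonDependent.Propositional using (_×-↔_)
open import Function.Base using (_∘_; id)
open import Function.Bundles using (_↔_; module Injection; module Inverse)
open import Function.Construct.Composition using (_↔-∘_)
open import Function.Properties.Inverse using (↔⇒↣)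
open import Level using (0ℓ)
open import Relation.Binary.PropositionalEquality using (_≡_; _≢_; refl; sym; trans; cong; cong₂; subst; subst₂)
open import Relation.Nullary using (¬_; Dec; yes; no; contradiction)
open import Relation.Nullary.Decidable using (_×-dec_; _⊎-dec_; ¬?; decidable-stable; from-yes; ⌊_⌋; toWitness)
open import Relation.Unary using (Pred; Decidable; U; _⊆_)

private
  variable
    n k : ℕ

lookup-injective : {u v : Bits n} → (∀ i → lookup u i ≡ lookup v i) → u ≡ v
lookup-injective {u = u} {v} eq =
  trans (sym (tabulate∘lookup u)) (trans (tabulate-cong eq) (tabulate∘lookup v))

_≟ᵛ_ : (u v : Bits n) → Dec (u ≡ v)
_≟ᵛ_ = ≡-dec Bool._≟_

≢-≢⇒≡ : {x y z : Bool} → x ≢ y → y ≢ z → x ≡ z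
≢-≢⇒≡ {y = y} x≢y y≢z = trans (Bool.¬-not x≢y) (sym (Bool.¬-not (y≢z ∘ sym)))

-- The Szabó-Welzl criterion.

SepAt : (u v x y : Bits n) → Fin n → Set
SepAt u v x y i = lookup u i ≢ lookup v i × lookup x i ≢ lookup y i

Separated : (u v x y : Bits n) → Set
Separated u v x y = ∃ (SepAt u v x y)

sepAt? : (u v x y : Bits n) → Decidable (SepAt u v x y)
sepAt? u v x y i =
  ¬? (lookup u i Bool.≟ lookup v i) ×-dec ¬? (lookup x i Bool.≟ lookup y i)

SzaboWelzl : Outmap n → Set
SzaboWelzl t = ∀ u v → u ≢ v → Separated u v (t u) (t v)

lookup-tail : (w : Bits (suc n)) (i : Fin n) → lookup (Vec.tail w) i ≡ lookup w (suc i)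
lookup-tail (_ ∷ _) i = refl

facet : Outmap (suc n) → Bool → Outmap n
facet t b x = Vec.tail (t (b ∷ x))

szaboWelzl-facet : (t : Outmap (suc n)) → SzaboWelzl t → ∀ b → SzaboWelzl (facet t b)
szaboWelzl-facet t sw b x y x≢y with sw (b ∷ x) (b ∷ y) (x≢y ∘ cong Vec.tail)
... | zero  , b≢b , _ = contradiction refl b≢b
... | suc i , x≢y , t≢ = i , x≢y , λ eq →
  t≢ (trans (sym (lookup-tail (t (b ∷ x)) i)) (trans eq (lookup-tail (t (b ∷ y)) i)))

face-∷ : ∀ {s c d I} {v w : Bits n} → (s ≡ outside → d ≡ c) →
         Face I v w → Face (s ∷ I) (c ∷ v) (d ∷ w)
face-∷ d≡c w∈F zero    0∉I = d≡c (Bool.¬-not (0∉I ∘ lookup⇒[]= zero _))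
face-∷ d≡c w∈F (suc i) i∉I = w∈F i (i∉I ∘ there)

sink-∷ : ∀ (t : Outmap (suc n)) {s c d I v w} → (s ≡ outside → d ≡ c) →
         (s ≡ inside → lookup (t (d ∷ w)) zero ≡ 𝟎) →
         SinkOf (facet t d) I v w → SinkOf t (s ∷ I) (c ∷ v) (d ∷ w)
sink-∷ t {d = d} {w = w} d≡c t₀≡0 (w∈F , w-sink) =
  face-∷ d≡c w∈F , λ where
    zero    0∈I → t₀≡0 ([]=⇒lookup 0∈I)
    (suc i) i∈I → trans (sym (lookup-tail (t (d ∷ w)) i)) (w-sink i (drop-there i∈I))

-- If neither facet sink is a sink of the face, both leave their facet in the
-- splitting dimension, and so their outmaps agree on the whole face.
szaboWelzl⇒sink : (t : Outmap n) → SzaboWelzl t → ∀ I v → ∃ (SinkOf t I v)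
szaboWelzl⇒sink t sw [] [] = [] , (λ ()) , λ ()
szaboWelzl⇒sink t sw (outside ∷ I) (c ∷ v)
  with w , sink ← szaboWelzl⇒sink (facet t c) (szaboWelzl-facet t sw c) I v =
  c ∷ w , sink-∷ t (λ _ → refl) (λ ()) sink
szaboWelzl⇒sink t sw (inside ∷ I) (c ∷ v)
  with w , sinkʷ ← szaboWelzl⇒sink (facet t 𝟎) (szaboWelzl-facet t sw 𝟎) I v
     | x , sinkˣ ← szaboWelzl⇒sink (facet t 𝟏) (szaboWelzl-facet t sw 𝟏) I v
  with lookup (t (𝟎 ∷ w)) zero Bool.≟ 𝟎 | lookup (t (𝟏 ∷ x)) zero Bool.≟ 𝟎
... | yes t₀≡0 | _ = 𝟎 ∷ w , sink-∷ t (λ ()) (λ _ → t₀≡0) sinkʷ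
... | no _ | yes t₀≡0 = 𝟏 ∷ x , sink-∷ t (λ ()) (λ _ → t₀≡0) sinkˣ
... | no t₀≢0 | no t₀≢0′ with sw (𝟎 ∷ w) (𝟏 ∷ x) (λ ())
...   | zero  , _   , t≢ = contradiction (≢-≢⇒≡ t₀≢0 (t₀≢0′ ∘ sym)) t≢
...   | suc i , w≢x , t≢ with i ∈? I
...     | no i∉I  = contradiction (trans (proj₁ sinkʷ i i∉I) (sym (proj₁ sinkˣ i i∉I))) w≢x
...     | yes i∈I = contradiction
  (trans (sym (lookup-tail (t (𝟎 ∷ w)) i)) (trans (proj₂ sinkʷ i i∈I)
    (trans (sym (proj₂ sinkˣ i i∈I)) (lookup-tail (t (𝟏 ∷ x)) i)))) t≢

-- The endpoints of an edge in dimension `i` differ only at `i`, so only `i` can separate them. Two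
-- sinks of a face agree as vertices outside `I` and in their outmaps on `I`, so nothing separates
-- them.
szaboWelzl⇒isUSO : {t : Outmap n} → SzaboWelzl t → IsUSO t
szaboWelzl⇒isUSO {t = t} sw = record
  { isOrientation = orientation
  ; uniqueSink    = λ I v →
      let u , sinkᵘ = szaboWelzl⇒sink t sw I v in u , sinkᵘ , unique I v sinkᵘ
  }
  where
  lookup-⊕⁅⁆ : ∀ u i j → lookup (u ⊕ ⁅ i ⁆) j ≡ lookup u j xor lookup ⁅ i ⁆ j
  lookup-⊕⁅⁆ u i j = lookup-zipWith _xor_ j u ⁅ i ⁆

  flipped : ∀ u i → lookup (u ⊕ ⁅ i ⁆) i ≡ not (lookup u i)
  flipped u i = trans (lookup-⊕⁅⁆ u i i)
    (trans (cong (lookup u i xor_) ([]=⇒lookup (x∈⁅x⁆ i)))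
      (Bool.xor-comm (lookup u i) 𝟏))

  kept : ∀ u i j → j ≢ i → lookup (u ⊕ ⁅ i ⁆) j ≡ lookup u j
  kept u i j j≢i = trans (lookup-⊕⁅⁆ u i j)
    (trans (cong (lookup u j xor_) (Bool.¬-not (j≢i ∘ x∈⁅y⁆⇒x≡y i ∘ lookup⇒[]= j ⁅ i ⁆)))
      (Bool.xor-identityʳ (lookup u j)))

  orientation : IsOrientation t
  orientation u i with sw (u ⊕ ⁅ i ⁆) u (λ eq →
    Bool.not-¬ (cong (λ w → lookup w i) eq) (flipped u i))
  ... | j , u≢ , t≢ with j Fin.≟ i
  ...   | yes refl = Bool.¬-not t≢
  ...   | no j≢i   = contradiction (kept u i j j≢i) u≢

  unique : ∀ I v {u w} → SinkOf t I v u → SinkOf t I v w → u ≡ w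
  unique I v {u} {w} (u∈F , u-sink) (w∈F , w-sink) with u ≟ᵛ w
  ... | yes u≡w = u≡w
  ... | no u≢w with sw u w u≢w
  ...   | i , u≢ , t≢ with i ∈? I
  ...     | no i∉I  = contradiction (trans (u∈F i i∉I) (sym (w∈F i i∉I))) u≢
  ...     | yes i∈I = contradiction (trans (u-sink i i∈I) (sym (w-sink i i∈I))) t≢

-- These vertices are the sinks of the face after flipping in `t` all dimensions where `z` is 𝟏.
Realises : Outmap n → Bits n → Subset n → Bits n → Pred (Bits n) 0ℓ
Realises t z I v u = Face I v u × (∀ i → i ∈ I → lookup (t u) i ≡ lookup z i)

UniquelyRealised : Outmap n → Bits n → Set
UniquelyRealised t z = ∀ I v → ∃! _≡_ (Realises t z I v)

-- The face splits along i into two facets, each with a unique vertex that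
-- realises z outside i. Exactly one of the two vertices realises z at i, so the
-- other one is the unique vertex realising the flip of z.
uniquelyRealised-flip : ∀ (t : Outmap n) z → UniquelyRealised t z →
                        ∀ i → UniquelyRealised t (updateAt z i not)
uniquelyRealised-flip t z real i I v with i ∈? I
... | no i∉I with w , (w∈F , w-real) , unique ← real I v =
  w , (w∈F , λ j j∈I → trans (w-real j j∈I) (sym (unflipped j j∈I)))
    , λ (x∈F , x-real) → unique (x∈F , λ j j∈I → trans (x-real j j∈I) (unflipped j j∈I))
  where
  unflipped : ∀ j → j ∈ I → lookup (updateAt z i not) j ≡ lookup z j
  unflipped j j∈I = lookup∘updateAt′ j i (λ { refl → i∉I j∈I }) z
... | yes i∈I with c , c-real , c-unique ← real I v =
  a , (a∈F , a-flips) , a-unique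
  where
  J = I [ i ]≔ outside
  z′ = updateAt z i not

  ∈J⇒≢ : ∀ {j} → j ∈ J → j ≢ i
  ∈J⇒≢ j∈J refl with () ← trans (sym ([]=⇒lookup j∈J)) (lookup∘update i I outside)

  ∈J⇒∈I : ∀ {j} → j ∈ J → j ∈ I
  ∈J⇒∈I {j} j∈J = lookup⇒[]= j I
    (trans (sym (lookup∘update′ (∈J⇒≢ j∈J) I outside)) ([]=⇒lookup j∈J))

  ∈I⇒∈J : ∀ {j} → j ≢ i → j ∈ I → j ∈ J
  ∈I⇒∈J {j} j≢i j∈I = lookup⇒[]= j J (trans (lookup∘update′ j≢i I outside) ([]=⇒lookup j∈I))

  v[_] : Bool → Bits _
  v[ b ] = v [ i ]≔ b

  ∈facet : ∀ {b} w → Face I v w → lookup w i ≡ b → Face J v[ b ] w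
  ∈facet {b} w w∈F wᵢ≡b j j∉J with j Fin.≟ i
  ... | yes refl = trans wᵢ≡b (sym (lookup∘update i v b))
  ... | no j≢i   = trans (w∈F j (j∉J ∘ ∈I⇒∈J j≢i)) (sym (lookup∘update′ j≢i v b))

  fromFacet : ∀ {b} w → Face J v[ b ] w → Face I v w × lookup w i ≡ b
  fromFacet {b} w w∈F =
    (λ j j∉I → trans (w∈F j (j∉I ∘ ∈J⇒∈I)) (lookup∘update′ (λ { refl → j∉I i∈I }) v b)) ,
    trans (w∈F i (λ i∈J → ∈J⇒≢ i∈J refl)) (lookup∘update i v b)

  -- `c` realises `z` on the whole face; the candidate for `z′` is taken from the facet that does
  -- not contain `c`.
  b = not (lookup c i)
  a = proj₁ (real J v[ b ])
  a-real = proj₁ (proj₂ (real J v[ b ]))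
  a∈F = proj₁ (fromFacet a (proj₁ a-real))

  a-flips-i : lookup (t a) i ≡ not (lookup z i)
  -- If `a` agreed with `z` at `i` as well, it would equal `c`, which lies in the opposite facet.
  a-flips-i = Bool.¬-not λ tᵢ≡zᵢ → Bool.not-¬ (cong (λ w → lookup w i) (c-unique {a} (a∈F , λ j j∈I →
    a-agrees tᵢ≡zᵢ j j∈I))) (sym (trans (cong not (proj₂ (fromFacet a (proj₁ a-real)))) (Bool.not-involutive _)))
    where
    a-agrees : lookup (t a) i ≡ lookup z i → ∀ j → j ∈ I → lookup (t a) j ≡ lookup z j
    a-agrees tᵢ≡zᵢ j j∈I with j Fin.≟ i
    ... | yes refl = tᵢ≡zᵢ
    ... | no j≢i   = proj₂ a-real j (∈I⇒∈J j≢i j∈I)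

  a-flips : ∀ j → j ∈ I → lookup (t a) j ≡ lookup z′ j
  a-flips j j∈I with j Fin.≟ i
  ... | yes refl = trans a-flips-i (sym (lookup∘updateAt i z))
  ... | no j≢i   = trans (proj₂ a-real j (∈I⇒∈J j≢i j∈I)) (sym (lookup∘updateAt′ j i j≢i z))

  realises-J : ∀ w → (∀ j → j ∈ I → lookup (t w) j ≡ lookup z′ j) →
               ∀ j → j ∈ J → lookup (t w) j ≡ lookup z j
  realises-J w w-real j j∈J =
    trans (w-real j (∈J⇒∈I j∈J)) (lookup∘updateAt′ j i (∈J⇒≢ j∈J) z)

  a-unique : ∀ {w} → Realises t z′ I v w → a ≡ w
  a-unique {w} (w∈F , w-real) with lookup w i Bool.≟ lookup c i
  ... | no wᵢ≢cᵢ =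
    proj₂ (proj₂ (real J v[ b ])) (∈facet w w∈F (Bool.¬-not wᵢ≢cᵢ) , realises-J w w-real)
  -- Uniqueness in the facet of `c` forces `w` to be `c`, which has the value of `z` at `i` and not
  -- its flip.
  ... | yes wᵢ≡cᵢ = contradiction
    (trans (sym (proj₂ c-real i i∈I)) (trans (cong (λ x → lookup (t x) i) c≡w) (w-real i i∈I)))
    (λ zᵢ≡z′ᵢ → Bool.not-¬ {x = lookup z i} refl (trans zᵢ≡z′ᵢ (lookup∘updateAt i z)))
    where
    w-unique = proj₂ (proj₂ (real J v[ lookup c i ]))
    c≡w : c ≡ w
    c≡w = trans
      (sym (w-unique (∈facet c (proj₁ c-real) refl , λ j j∈J → proj₂ c-real j (∈J⇒∈I j∈J))))
      (w-unique (∈facet w w∈F wᵢ≡cᵢ , realises-J w w-real))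

updateAt-induction : (P : Pred (Bits n) 0ℓ) → P (Vec.replicate n 𝟎) →
                     (∀ z → P z → ∀ i → P (updateAt z i not)) → ∀ z → P z
updateAt-induction P P0 flip [] = P0
updateAt-induction P P0 flip (b ∷ z)
  with P0z ← updateAt-induction (P ∘ (𝟎 ∷_)) P0 (λ z Pz i → flip (𝟎 ∷ z) Pz (suc i)) z
  with b
... | 𝟎 = P0z
... | 𝟏 = flip (𝟎 ∷ z) P0z zero

isUSO⇒uniquelyRealised : {t : Outmap n} → IsUSO t → ∀ z → UniquelyRealised t z
isUSO⇒uniquelyRealised {n} {t} uso =
  updateAt-induction (UniquelyRealised t) sinks (uniquelyRealised-flip t)
  where
  sinks : UniquelyRealised t (Vec.replicate n 𝟎)
  sinks I v with w , (w∈F , w-sink) , unique ← IsUSO.uniqueSink uso I v =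
    w , (w∈F , λ i i∈I → trans (w-sink i i∈I) (sym (lookup-replicate i 𝟎)))
      , λ (x∈F , x-real) → unique (x∈F , λ i i∈I → trans (x-real i i∈I) (lookup-replicate i 𝟎))

-- Read as a subset, `u ⊕ v` holds the dimensions of the smallest face containing `u` and `v`. If
-- they were not separated, both would realise `t u` there.
isUSO⇒szaboWelzl : {t : Outmap n} → IsUSO t → SzaboWelzl t
isUSO⇒szaboWelzl {t = t} uso u v u≢v with any? (sepAt? u v (t u) (t v))
... | yes sep = sep
... | no ¬sep = contradiction (trans (sym (unique u-real)) (unique v-real)) u≢v
  where
  lookup-⊕ : ∀ i → lookup (u ⊕ v) i ≡ lookup u i xor lookup v i
  lookup-⊕ i = lookup-zipWith _xor_ i u v

  ∉⇒≡ : ∀ i → i ∉ u ⊕ v → lookup v i ≡ lookup u i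
  ∉⇒≡ i i∉ with lookup v i Bool.≟ lookup u i
  ... | yes eq = eq
  ... | no neq = contradiction
    (lookup⇒[]= i (u ⊕ v) (trans (lookup-⊕ i) (trans (cong (lookup u i xor_) (Bool.¬-not neq))
      (Bool.xor-inverseʳ (lookup u i))))) i∉

  ∈⇒≢ : ∀ i → i ∈ u ⊕ v → lookup u i ≢ lookup v i
  ∈⇒≢ i i∈ eq with () ← trans (sym ([]=⇒lookup i∈)) (trans (lookup-⊕ i)
    (trans (cong (_xor lookup v i) eq) (Bool.xor-same (lookup v i))))

  unique : ∀ {w} → Realises t (t u) (u ⊕ v) u w → _ ≡ w
  unique = proj₂ (proj₂ (isUSO⇒uniquelyRealised uso (t u) (u ⊕ v) u))

  u-real : Realises t (t u) (u ⊕ v) u u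
  u-real = (λ _ _ → refl) , λ _ _ → refl

  v-real : Realises t (t u) (u ⊕ v) u v
  v-real = ∉⇒≡ , λ i i∈ → decidable-stable (lookup (t v) i Bool.≟ lookup (t u) i)
    (λ neq → ¬sep (i , ∈⇒≢ i i∈ , neq ∘ sym))

-- Merging two facets along a dimension.

lookup-removeAt : (u : Bits (suc n)) (i : Fin (suc n)) (j : Fin n) →
                  lookup (removeAt u i) j ≡ lookup u (punchIn i j)
lookup-removeAt (_ ∷ _)       zero    j       = refl
lookup-removeAt (_ ∷ _ ∷ _)   (suc i) zero    = refl
lookup-removeAt (_ ∷ u@(_ ∷ _)) (suc i) (suc j) = lookup-removeAt u i j

removeAt-cong⁻ : (u v : Bits (suc n)) (i : Fin (suc n)) →
                 lookup u i ≡ lookup v i → removeAt u i ≡ removeAt v i → u ≡ v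
removeAt-cong⁻ u v i uᵢ≡vᵢ eq = trans (sym (insertAt-removeAt u i))
  (trans (cong₂ (λ w b → insertAt w i b) eq uᵢ≡vᵢ) (insertAt-removeAt v i))

xor-cancelˡ : ∀ x y → x xor (x xor y) ≡ y
xor-cancelˡ 𝟎 y = refl
xor-cancelˡ 𝟏 y = Bool.not-involutive y

xor-≢ʳ : ∀ x {y z} → y ≢ z → y xor x ≢ z xor x
xor-≢ʳ 𝟎 {𝟎} {𝟎} y≢z _ = y≢z refl
xor-≢ʳ 𝟎 {𝟏} {𝟏} y≢z _ = y≢z refl
xor-≢ʳ 𝟏 {𝟎} {𝟎} y≢z _ = y≢z refl
xor-≢ʳ 𝟏 {𝟏} {𝟏} y≢z _ = y≢z refl

xor-≢-≢ : ∀ {x x′ y y′} → x ≢ x′ → y ≢ y′ → x xor y ≡ x′ xor y′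
xor-≢-≢ {x′ = x′} {y′ = y′} x≢x′ y≢y′ =
  trans (cong₂ _xor_ (Bool.¬-not x≢x′) (Bool.¬-not y≢y′)) (Bool.xor-annihilates-not x′ y′)

-- The edge in dimension i over x is directed by o x: its endpoint with bit b
-- at i has the outmap bit b xor o x.
merge : Fin (suc n) → (Bool → Outmap n) → (Bits n → Bool) → Outmap (suc n)
merge i t o u = insertAt (t (lookup u i) (removeAt u i)) i (lookup u i xor o (removeAt u i))

-- Edges over vertices where the two halves agree may be directed arbitrarily.
szaboWelzl-merge : ∀ (i : Fin (suc n)) t o d → (∀ b → SzaboWelzl (t b)) →
                   (∀ x → o x ≢ d → ∀ b c → t b x ≡ t c x) →
                   SzaboWelzl (merge i t o)
szaboWelzl-merge {n} i t o d sw agree u v u≢v = go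
  where
  x = removeAt u i
  y = removeAt v i

  m[u] = merge i t o u
  m[v] = merge i t o v

  atI : lookup u i ≢ lookup v i → o x ≡ o y → Separated u v m[u] m[v]
  atI uᵢ≢vᵢ ox≡oy = i , uᵢ≢vᵢ , λ eq → xor-≢ʳ (o y) uᵢ≢vᵢ
    (trans (cong (lookup u i xor_) (sym ox≡oy))
      (trans (sym (insertAt-lookup (t (lookup u i) x) i _))
        (trans eq (insertAt-lookup (t (lookup v i) y) i _))))

  elsewhere : x ≢ y → ∀ b → t b x ≡ t (lookup u i) x → t b y ≡ t (lookup v i) y →
              Separated u v m[u] m[v]
  elsewhere x≢y b tx≡ ty≡ with sw b x y x≢y
  ... | j , xⱼ≢yⱼ , t≢ = punchIn i j
    , (λ eq → xⱼ≢yⱼ (trans (lookup-removeAt u i j) (trans eq (sym (lookup-removeAt v i j)))))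
    , (λ eq → t≢ (trans (cong (λ w → lookup w j) tx≡)
        (trans (sym (insertAt-punchIn (t (lookup u i) x) i _ j))
          (trans eq (trans (insertAt-punchIn (t (lookup v i) y) i _ j)
            (sym (cong (λ w → lookup w j) ty≡)))))))

  go : Separated u v m[u] m[v]
  go with lookup u i Bool.≟ lookup v i
  ... | yes uᵢ≡vᵢ = elsewhere (u≢v ∘ removeAt-cong⁻ u v i uᵢ≡vᵢ) (lookup u i) refl
                      (cong (λ b → t b y) uᵢ≡vᵢ)
  ... | no uᵢ≢vᵢ with x ≟ᵛ y
  ...   | yes x≡y = atI uᵢ≢vᵢ (cong o x≡y)
  ...   | no x≢y with o x Bool.≟ d | o y Bool.≟ d
  ...     | yes ox≡d | yes oy≡d = atI uᵢ≢vᵢ (trans ox≡d (sym oy≡d))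
  -- The halves agree over an exceptional `x`, so `x` and `y` can be compared in the half of `y`.
  ...     | no ox≢d  | _        = elsewhere x≢y (lookup v i) (agree x ox≢d _ _) refl
  ...     | yes _    | no oy≢d  = elsewhere x≢y (lookup u i) refl (agree y oy≢d _ _)

-- Extending prescribed values by induction on the dimension.

PairwiseSep : Pred (Fin k) 0ℓ → (p q : Fin k → Bits n) → Set
PairwiseSep S p q = ∀ {j l} → S j → S l → j ≢ l → Separated (p j) (p l) (q j) (q l)

-- The index set `Fin k` stays fixed throughout the induction; passing to a facet only shrinks `S`
-- and deletes a coordinate.
Extendable : Pred (Fin k) 0ℓ → (p q : Fin k → Bits n) → Set
Extendable S p q = ∃ λ t → SzaboWelzl t × (∀ {j} → S j → t (p j) ≡ q j)

module _ (p q : Fin k → Bits (suc n)) (i : Fin (suc n)) where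

  private
    p′ q′ : Fin k → Bits n
    p′ j = removeAt (p j) i
    q′ j = removeAt (q j) i

  class : Fin k → Bool × Bool
  class j = lookup (p j) i , lookup (q j) i

  direction : Fin k → Bool
  direction j = lookup (p j) i xor lookup (q j) i

  SepElsewhere : Fin k → Fin k → Set
  SepElsewhere j l = ∃ λ i′ → i ≢ i′ × SepAt (p j) (p l) (q j) (q l) i′

  sepElsewhere⇒separated : ∀ {j l} → SepElsewhere j l → Separated (p′ j) (p′ l) (q′ j) (q′ l)
  sepElsewhere⇒separated {j} {l} (i′ , i≢i′ , p≢ , q≢) =
    punchOut i≢i′ , p≢ ∘ lookups p , q≢ ∘ lookups q
    where
    lookups : ∀ (r : Fin k → Bits (suc n)) →
              lookup (removeAt (r j) i) (punchOut i≢i′) ≡ lookup (removeAt (r l) i) (punchOut i≢i′) →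
              lookup (r j) i′ ≡ lookup (r l) i′
    lookups r eq = trans (sym (removeAt-punchOut (r j) i≢i′)) (trans eq (removeAt-punchOut (r l) i≢i′))

  module _ (S : Pred (Fin k) 0ℓ) where

    -- The points that the half of the cube with bit b at i has to respect if the
    -- edges in dimension i have direction d by default: its own points, and the
    -- points of the other half at edges with the exceptional direction.
    Half : Bool → Bool → Pred (Fin k) 0ℓ
    Half d b j = S j × (lookup (p j) i ≡ b ⊎ direction j ≢ d)

    -- A point at an exceptional edge belongs to both halves, so the two completions agree there, as
    -- `szaboWelzl-merge` requires.
    extendable-split : Decidable S → PairwiseSep S p q →
                       ∀ d → (∀ b → Extendable (Half d b) p′ q′) → Extendable S p q
    extendable-split S? sep d ext =
      merge i t o , szaboWelzl-merge i t o d (λ b → proj₁ (proj₂ (ext b))) agree , extends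
      where
      t = λ b → proj₁ (ext b)

      t-extends : ∀ {b j} → Half d b j → t b (p′ j) ≡ q′ j
      t-extends {b} = proj₂ (proj₂ (ext b))

      over? : ∀ x → Dec (∃ λ j → S j × p′ j ≡ x)
      over? x = any? (λ j → S? j ×-dec (p′ j ≟ᵛ x))

      o : Bits n → Bool
      o x with over? x
      ... | yes (j , _) = direction j
      ... | no _        = d

      agree : ∀ x → o x ≢ d → ∀ b c → t b x ≡ t c x
      agree x ox≢d b c with over? x
      ... | no _ = contradiction refl ox≢d
      ... | yes (j , Sj , refl) = trans (t-extends (Sj , inj₂ ox≢d)) (sym (t-extends (Sj , inj₂ ox≢d)))

      -- The search over `p′ j` may find another point `l`. It differs from `p j` only at `i`, so
      -- `i` separates the two and their directions coincide.
      o-direction : ∀ {j} → S j → o (p′ j) ≡ direction j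
      o-direction {j} Sj with over? (p′ j)
      ... | no ¬over = contradiction (j , Sj , refl) ¬over
      ... | yes (l , Sl , p′l≡p′j) with l Fin.≟ j
      ...   | yes refl = refl
      ...   | no l≢j with sep Sl Sj l≢j
      ...     | i′ , sep-i′ with i Fin.≟ i′
      ...       | yes refl = xor-≢-≢ (proj₁ sep-i′) (proj₂ sep-i′)
      ...       | no i≢i′  = contradiction (cong (λ w → lookup w _) p′l≡p′j)
                               (proj₁ (proj₂ (sepElsewhere⇒separated (i′ , i≢i′ , sep-i′))))

      extends : ∀ {j} → S j → merge i t o (p j) ≡ q j
      extends {j} Sj = trans
        (cong₂ (λ w b → insertAt w i b) (t-extends (Sj , inj₁ refl))
          (trans (cong (lookup (p j) i xor_) (o-direction Sj)) (xor-cancelˡ (lookup (p j) i) _)))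
        (insertAt-removeAt (q j) i)

    -- Two points separated at `i` have the same direction. If it is `d`, they lie in different
    -- halves and need not be compared; only pairs of the exceptional direction need another
    -- separating dimension.
    pairwiseSep-half : PairwiseSep S p q → ∀ d →
      (∀ {j l} → S j → S l → direction j ≢ d → SepAt (p j) (p l) (q j) (q l) i → SepElsewhere j l) →
      ∀ b → PairwiseSep (Half d b) p′ q′
    pairwiseSep-half sep d reSep b {j} {l} (Sj , j∈b) (Sl , l∈b) j≢l
      with sep Sj Sl j≢l
    ... | i′ , sep-i′ with i Fin.≟ i′
    ...   | no i≢i′ = sepElsewhere⇒separated (i′ , i≢i′ , sep-i′)
    ...   | yes refl with direction j Bool.≟ d
    ...     | no dirⱼ≢d = sepElsewhere⇒separated (reSep Sj Sl dirⱼ≢d sep-i′)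
    ...     | yes dirⱼ≡d = contradiction
      (trans ([ id , contradiction dirⱼ≡d ]′ j∈b)
        (sym ([ id , contradiction (trans (sym (xor-≢-≢ (proj₁ sep-i′) (proj₂ sep-i′))) dirⱼ≡d) ]′ l∈b)))
      (proj₁ sep-i′)

-- Stands for a bound of three on the size of `S`, in the form that yields an empty class in any
-- dimension.
NotOntoBool² : Pred (Fin k) 0ℓ → Set
NotOntoBool² {k} S = (c : Fin k → Bool × Bool) → ¬ (∀ d → ∃ λ j → S j × c j ≡ d)

notOntoBool²-⊆ : {S S′ : Pred (Fin k) 0ℓ} → S′ ⊆ S → NotOntoBool² S → NotOntoBool² S′
notOntoBool²-⊆ S′⊆S notOnto c onto = notOnto c λ d →
  let j , S′j , cj≡d = onto d in j , S′⊆S S′j , cj≡d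

4↔Bool² : Fin 4 ↔ (Bool × Bool)
4↔Bool² = (Fin.2↔Bool ×-↔ Fin.2↔Bool) ↔-∘ Fin.*↔×

-- Pigeonhole: chosen preimages would inject four classes into the three indices other than `m`.
notOntoBool²-≢ : (m : Fin 4) → NotOntoBool² (_≢ m)
notOntoBool²-≢ m c onto = 1+n≰n (injective⇒≤ injective)
  where
  preimage : ∀ x → ∃ λ j → j ≢ m × c j ≡ Inverse.to 4↔Bool² x
  preimage = onto ∘ Inverse.to 4↔Bool²

  omit : Fin 4 → Fin 3
  omit x = punchOut (proj₁ (proj₂ (preimage x)) ∘ sym)

  injective : ∀ {x y} → omit x ≡ omit y → x ≡ y
  injective {x} {y} eq = Injection.injective (↔⇒↣ 4↔Bool²)
    (trans (sym (proj₂ (proj₂ (preimage x))))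
      (trans (cong c (punchOut-injective (proj₁ (proj₂ (preimage x)) ∘ sym) _ eq))
        (proj₂ (proj₂ (preimage y)))))

∀⊎∃¬-Bool² : {P : Pred (Bool × Bool) 0ℓ} → Decidable P → (∀ d → P d) ⊎ ∃ (¬_ ∘ P)
∀⊎∃¬-Bool² P? with P? (𝟎 , 𝟎) | P? (𝟎 , 𝟏) | P? (𝟏 , 𝟎) | P? (𝟏 , 𝟏)
... | no ¬P | _ | _ | _ = inj₂ (_ , ¬P)
... | yes _ | no ¬P | _ | _ = inj₂ (_ , ¬P)
... | yes _ | yes _ | no ¬P | _ = inj₂ (_ , ¬P)
... | yes _ | yes _ | yes _ | no ¬P = inj₂ (_ , ¬P)
... | yes P₀₀ | yes P₀₁ | yes P₁₀ | yes P₁₁ = inj₁ λ where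
  (𝟎 , 𝟎) → P₀₀
  (𝟎 , 𝟏) → P₀₁
  (𝟏 , 𝟎) → P₁₀
  (𝟏 , 𝟏) → P₁₁

module _ (p q : Fin k → Bits (suc n)) (i : Fin (suc n)) {S : Pred (Fin k) 0ℓ} (S? : Decidable S) where

  classes? : Decidable (λ d → ∃ λ j → S j × class p q i j ≡ d)
  classes? (c , e) = any? λ j → S? j ×-dec ≡-dec² (class p q i j) (c , e)
    where ≡-dec² = Product.≡-dec Bool._≟_ Bool._≟_

  half? : ∀ d b → Decidable (Half p q i S d b)
  half? d b j = S? j ×-dec
    ((lookup (p j) i Bool.≟ b) ⊎-dec ¬? (direction p q i j Bool.≟ d))

-- Points separated at i lie in opposite classes, with the same direction.
emptyClass⇒¬sepAt : ∀ (p q : Fin k → Bits (suc n)) i {S : Pred (Fin k) 0ℓ} c e →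
  ¬ (∃ λ j → S j × class p q i j ≡ (c , e)) →
  ∀ {j l} → S j → S l → direction p q i j ≢ not (c xor e) →
  ¬ SepAt (p j) (p l) (q j) (q l) i
emptyClass⇒¬sepAt p q i {S} c e empty {j} {l} Sj Sl dirⱼ≢ (p≢ , q≢) =
  [ absurd Sj dirⱼ , absurd Sl (trans (sym (xor-≢-≢ p≢ q≢)) dirⱼ) ]′ c-occurs
  where
  dirⱼ : direction p q i j ≡ c xor e
  dirⱼ = trans (Bool.¬-not dirⱼ≢) (Bool.not-involutive _)

  absurd : ∀ {m} → S m → direction p q i m ≡ c xor e → lookup (p m) i ≢ c
  absurd {m} Sm dirₘ pₘ≡c = empty (m , Sm , cong₂ _,_ pₘ≡c
    (trans (sym (xor-cancelˡ (lookup (p m) i) _))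
      (trans (cong₂ _xor_ pₘ≡c dirₘ) (xor-cancelˡ c e))))

  c-occurs : lookup (p j) i ≡ c ⊎ lookup (p l) i ≡ c
  c-occurs with lookup (p j) i Bool.≟ c
  ... | yes pⱼ≡c = inj₁ pⱼ≡c
  ... | no pⱼ≢c  = inj₂ (≢-≢⇒≡ (p≢ ∘ sym) pⱼ≢c)

-- Some class in dimension i is empty; the direction of the two adjacent
-- classes serves as the default.
extendable-small : (p q : Fin k → Bits n) {S : Pred (Fin k) 0ℓ} → Decidable S →
                   NotOntoBool² S → PairwiseSep S p q → Extendable S p q
extendable-small {n = ℕ.zero} p q S? notOnto sep =
  id , (λ { [] [] u≢v → contradiction refl u≢v }) , λ {j} _ → Bits0 (p j) (q j)
  where
  Bits0 : (u v : Bits 0) → u ≡ v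
  Bits0 [] [] = refl
extendable-small {n = suc n} p q {S} S? notOnto sep
  with ∀⊎∃¬-Bool² (classes? p q zero S?)
... | inj₁ onto = contradiction onto (notOnto _)
... | inj₂ ((c , e) , empty) = extendable-split p q zero S S? sep d λ b →
  extendable-small _ _ (half? p q zero S? d b) (notOntoBool²-⊆ proj₁ notOnto)
    (pairwiseSep-half p q zero S sep d
      (λ Sj Sl dir≢ sep₀ → contradiction sep₀ (emptyClass⇒¬sepAt p q zero c e empty Sj Sl dir≢)) b)
  where d = not (c xor e)

-- Four separated points without a common extension.

module FourPoints (p q : Fin 4 → Bits (suc n)) (sep : PairwiseSep U p q) (¬ext : ¬ Extendable U p q)
  (p-takes : ∀ i b → ∃ λ j → lookup (p j) i ≡ b) (q-takes : ∀ i b → ∃ λ j → lookup (q j) i ≡ b)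
  where

  SepAt′ : Fin (suc n) → Fin 4 → Fin 4 → Set
  SepAt′ i j l = SepAt (p j) (p l) (q j) (q l) i

  -- A point of default direction in one facet is omitted by the half of the other facet. With such
  -- a point in each facet, both halves have at most three points and extend.
  splittable-absurd : ∀ i d →
    (∀ {j l} → direction p q i j ≢ d → SepAt′ i j l → SepElsewhere p q i j l) →
    ¬ (∀ b → ∃ λ j → lookup (p j) i ≡ b × direction p q i j ≡ d)
  splittable-absurd i d reSep omitted = ¬ext (extendable-split p q i U (λ _ → yes _) sep d λ b →
    extendable-small _ _ (half? p q i (λ _ → yes _) d b)
      (let m , pₘ≡ , dirₘ≡ = omitted (not b) in
        notOntoBool²-⊆ (λ { (_ , inj₁ pₘ≡b) refl → Bool.not-¬ pₘ≡b pₘ≡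
                          ; (_ , inj₂ dirₘ≢) refl → dirₘ≢ dirₘ≡ })
          (notOntoBool²-≢ m))
      (pairwiseSep-half p q i U sep d (λ _ _ → reSep) b))

  -- If `(c , e)` is empty, a point with vertex bit `c` lies in `(c , not e)` and a point with value
  -- bit `e` in `(not c , e)`. These are points of default direction in both facets.
  class-onto : ∀ i d → ∃ λ j → class p q i j ≡ d
  class-onto i with ∀⊎∃¬-Bool² (classes? p q i {U} (λ _ → yes _))
  ... | inj₁ onto = λ d → let j , _ , eq = onto d in j , eq
  ... | inj₂ ((c , e) , empty) = contradiction adjacent (splittable-absurd i (not (c xor e))
    (λ dir≢ sepᵢ → contradiction sepᵢ (emptyClass⇒¬sepAt p q i c e empty _ _ dir≢)))
    where
    adjacent : ∀ b → ∃ λ j → lookup (p j) i ≡ b × direction p q i j ≡ not (c xor e)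
    adjacent b with b Bool.≟ c
    ... | yes refl with j , pⱼ≡ ← p-takes i b = j , pⱼ≡ , trans
      (cong₂ _xor_ pⱼ≡ (Bool.¬-not (λ qⱼ≡e → empty (j , _ , cong₂ _,_ pⱼ≡ qⱼ≡e))))
      (sym (Bool.not-distribʳ-xor b e))
    ... | no b≢c with j , qⱼ≡ ← q-takes i e =
      j , ≢-≢⇒≡ pⱼ≢c (b≢c ∘ sym) , trans (cong₂ _xor_ (Bool.¬-not pⱼ≢c) qⱼ≡)
        (sym (Bool.not-distribˡ-xor c e))
      where
      pⱼ≢c : lookup (p j) i ≢ c
      pⱼ≢c pⱼ≡c = empty (j , _ , cong₂ _,_ pⱼ≡c qⱼ≡)

  class-injective : ∀ i {j l} → class p q i j ≡ class p q i l → j ≡ l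
  class-injective i {j} {l} eq with j Fin.≟ l
  ... | yes j≡l = j≡l
  ... | no j≢l  = contradiction onto-≢ (notOntoBool²-≢ l (class p q i))
    where
    onto-≢ : ∀ d → ∃ λ m → m ≢ l × class p q i m ≡ d
    onto-≢ d with m , eqₘ ← class-onto i d with m Fin.≟ l
    ... | yes refl = j , j≢l , trans eq eqₘ
    ... | no m≢l   = m , m≢l , eqₘ

  sepAt-injective : ∀ i {j l m} → SepAt′ i j l → SepAt′ i j m → l ≡ m
  sepAt-injective i (p≢ , q≢) (p≢′ , q≢′) =
    class-injective i (cong₂ _,_ (≢-≢⇒≡ (p≢ ∘ sym) p≢′) (≢-≢⇒≡ (q≢ ∘ sym) q≢′))

  -- Pairs separated at i in the direction of {j, l} coincide with {j, l}.
  sepAt-unique : ∀ {i i′ j l} → SepAt′ i j l → SepAt′ i′ j l → i ≡ i′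
  sepAt-unique {i} {i′} {j} {l} sepᵢ sepᵢ′ with i Fin.≟ i′
  ... | yes i≡i′ = i≡i′
  ... | no i≢i′  = contradiction occurs (splittable-absurd i d reSep)
    where
    -- This default makes `{j, l}` the only pair that loses its separation at `i`, and `i′` still
    -- separates it.
    d = not (direction p q i j)

    occurs : ∀ b → ∃ λ m → lookup (p m) i ≡ b × direction p q i m ≡ d
    occurs b with m , eq ← class-onto i (b , b xor d) =
      m , cong proj₁ eq , trans (cong (λ (x , y) → x xor y) eq) (xor-cancelˡ b d)

    sameClass : ∀ {m m′} → lookup (p m) i ≡ lookup (p m′) i →
                direction p q i m ≡ direction p q i m′ → m ≡ m′
    sameClass {m} {m′} pₘ≡ dirₘ≡ = class-injective i (cong₂ _,_ pₘ≡
      (trans (sym (xor-cancelˡ (lookup (p m) i) _))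
        (trans (cong₂ _xor_ pₘ≡ dirₘ≡) (xor-cancelˡ (lookup (p m′) i) _))))

    reSep : ∀ {j′ l′} → direction p q i j′ ≢ d → SepAt′ i j′ l′ → SepElsewhere p q i j′ l′
    reSep {j′} {l′} dir≢ sep′ᵢ with lookup (p j′) i Bool.≟ lookup (p j) i
    ... | yes pⱼ′≡pⱼ
      with refl ← sameClass pⱼ′≡pⱼ (trans (Bool.¬-not dir≢) (Bool.not-involutive _))
      with refl ← sepAt-injective i sepᵢ sep′ᵢ = i′ , i≢i′ , sepᵢ′
    ... | no pⱼ′≢pⱼ
      with refl ← sameClass {j′} {l} (≢-≢⇒≡ pⱼ′≢pⱼ (proj₁ sepᵢ))
        (trans (Bool.¬-not dir≢) (trans (Bool.not-involutive _) (xor-≢-≢ (proj₁ sepᵢ) (proj₂ sepᵢ))))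
      with refl ← sepAt-injective i (proj₁ sepᵢ ∘ sym , proj₂ sepᵢ ∘ sym) sep′ᵢ =
      i′ , i≢i′ , proj₁ sepᵢ′ ∘ sym , proj₂ sepᵢ′ ∘ sym

  separatingDim : Fin 3 → Fin (suc n)
  separatingDim m = proj₁ (sep {zero} {suc m} _ _ (λ ()))

  sepAt-separatingDim : ∀ m → SepAt′ (separatingDim m) zero (suc m)
  sepAt-separatingDim m = proj₂ (sep {zero} {suc m} _ _ (λ ()))

  opposite : ∀ i → ∃ λ m → SepAt′ i zero (suc m)
  opposite i with class-onto i (not (lookup (p zero) i) , not (lookup (q zero) i))
  ... | zero  , eq = contradiction (cong proj₁ eq) (Bool.not-¬ refl)
  ... | suc m , eq = m , (λ p≡ → Bool.not-¬ (sym p≡) (cong proj₁ eq))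
                       , (λ q≡ → Bool.not-¬ (sym q≡) (cong proj₂ eq))

  -- Each dimension separates the point 0 from exactly one other point, and each other point is
  -- separated from it in exactly one dimension.
  dimensions : Permutation 3 (suc n)
  dimensions = permutation separatingDim (proj₁ ∘ opposite)
    (λ i → sepAt-unique (sepAt-separatingDim _) (proj₂ (opposite i)))
    (λ m → Fin.suc-injective (sepAt-injective (separatingDim m)
      (proj₂ (opposite (separatingDim m))) (sepAt-separatingDim m)))

-- Normal form of a single dimension.

-- A dimension that separates 0 from suc m gives a partition of the four points
-- into two pairs by the vertices and another one by the outmap values, neither
-- of them {0, suc m}. Normalised at the point 0, these are `column m b` and
-- `column m (not b)`; cyclic permutations of 1, 2, 3 preserve b, transpositions
-- flip it.
column : Fin 3 → Bool → Vec Bool 4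
column 0F b = 𝟎 ∷ 𝟏 ∷ b ∷ not b ∷ []
column 1F b = 𝟎 ∷ not b ∷ 𝟏 ∷ b ∷ []
column 2F b = 𝟎 ∷ b ∷ not b ∷ 𝟏 ∷ []

Columns : (f g : Fin 4 → Bool) → Fin 3 → Bool → Set
Columns f g m b = ∀ j → (f j ≡ f zero xor lookup (column m b) j) ×
                        (g j ≡ g zero xor lookup (column m (not b)) j)

module _ (f g : Fin 4 → Bool) (inj : ∀ {j l} → f j ≡ f l → g j ≡ g l → j ≡ l) where

  -- By injectivity, each of the two remaining points differs from the point 0 in exactly one of `f`
  -- and `g`, and the two do so in different ones. One bit of freedom is left.
  columns : ∀ m → f zero ≢ f (suc m) → g zero ≢ g (suc m) → ∃ (Columns f g m)
  columns m f≢ g≢ = go m f≢ g≢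
    where
    to-xor : ∀ x y → y ≡ x xor (x xor y)
    to-xor x y = sym (xor-cancelˡ x y)

    differs : ∀ {x y} → x ≢ y → y ≡ x xor 𝟏
    differs {x} x≢y = trans (Bool.¬-not (x≢y ∘ sym)) (Bool.xor-comm 𝟏 x)

    same : ∀ x → x ≡ x xor 𝟎
    same x = sym (Bool.xor-identityʳ x)

    module _ {m} (f≢ : f zero ≢ f (suc m)) (g≢ : g zero ≢ g (suc m)) where

      complementary : ∀ j → j ≢ zero → j ≢ suc m → g j ≡ g zero xor not (f zero xor f j)
      complementary j j≢0 j≢m with f j Bool.≟ f zero
      ... | yes fⱼ≡f₀ = trans (differs (λ g₀≡gⱼ → j≢0 (inj fⱼ≡f₀ (sym g₀≡gⱼ))))
        (cong (λ x → g zero xor not x)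
          (sym (trans (cong (f zero xor_) fⱼ≡f₀) (Bool.xor-same (f zero)))))
      ... | no fⱼ≢f₀ = trans (≢-≢⇒≡ (λ gⱼ≡ → j≢m (inj (≢-≢⇒≡ fⱼ≢f₀ f≢) gⱼ≡)) (g≢ ∘ sym))
        (trans (same (g zero)) (cong (λ x → g zero xor not x)
          (sym (trans (cong (f zero xor_) (differs (fⱼ≢f₀ ∘ sym))) (xor-cancelˡ (f zero) 𝟏)))))

      distinct : ∀ j l → j ≢ l → j ≢ zero → l ≢ zero → j ≢ suc m → l ≢ suc m →
                 f zero xor f l ≡ not (f zero xor f j)
      distinct j l j≢l j≢0 l≢0 j≢m l≢m = Bool.¬-not λ eq → j≢l (inj
        (trans (to-xor (f zero) (f j)) (trans (cong (f zero xor_) (sym eq)) (xor-cancelˡ (f zero) (f l))))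
        (trans (complementary j j≢0 j≢m) (trans (cong (λ x → g zero xor not x) (sym eq))
          (sym (complementary l l≢0 l≢m)))))

      next : ∀ j → j ≢ zero → j ≢ suc m →
             (f j ≡ f zero xor (f zero xor f j)) × (g j ≡ g zero xor not (f zero xor f j))
      next j j≢0 j≢m = to-xor (f zero) (f j) , complementary j j≢0 j≢m

      last : ∀ j l → j ≢ l → j ≢ zero → l ≢ zero → j ≢ suc m → l ≢ suc m →
             (f l ≡ f zero xor not (f zero xor f j)) × (g l ≡ g zero xor not (not (f zero xor f j)))
      last j l j≢l j≢0 l≢0 j≢m l≢m =
        trans (to-xor (f zero) (f l)) (cong (f zero xor_) eq) ,
        trans (complementary l l≢0 l≢m) (cong (λ x → g zero xor not x) eq)
        where eq = distinct j l j≢l j≢0 l≢0 j≢m l≢m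

    go : ∀ m → f zero ≢ f (suc m) → g zero ≢ g (suc m) → ∃ (Columns f g m)
    -- The witness is read off at the position where `column m b` has the entry `b`: 2, 3 and 1 in
    -- the three clauses.
    go 0F f≢ g≢ = f zero xor f 2F , λ where
      0F → same _ , same _
      1F → differs f≢ , differs g≢
      2F → next f≢ g≢ 2F (λ ()) (λ ())
      3F → last f≢ g≢ 2F 3F (λ ()) (λ ()) (λ ()) (λ ()) (λ ())
    go 1F f≢ g≢ = f zero xor f 3F , λ where
      0F → same _ , same _
      2F → differs f≢ , differs g≢
      3F → next f≢ g≢ 3F (λ ()) (λ ())
      1F → last f≢ g≢ 3F 1F (λ ()) (λ ()) (λ ()) (λ ()) (λ ())
    go 2F f≢ g≢ = f zero xor f 1F , λ where
      0F → same _ , same _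
      3F → differs f≢ , differs g≢
      1F → next f≢ g≢ 1F (λ ()) (λ ())
      2F → last f≢ g≢ 1F 2F (λ ()) (λ ()) (λ ()) (λ ()) (λ ())

Shape : (p q : Fin 4 → Bits n) → (Fin 3 → Fin n) → Bits 3 → Set
Shape p q ι o = ∀ m → Columns (λ j → lookup (p j) (ι m)) (λ j → lookup (q j) (ι m)) m (lookup o m)

-- Isomorphisms from matching enumerations.

record Enumerates (s : PartialOutmap n) (p q : Fin k → Bits n) : Set where
  field
    values   : ∀ j → s (p j) ≡ just (q j)
    complete : ∀ {u x} → s u ≡ just x → ∃ λ j → p j ≡ u

lookup-permute : ∀ (π : Permutation′ n) u i → lookup (permute π u) (π ⟨$⟩ʳ i) ≡ lookup u i
lookup-permute π u i = trans (lookup∘tabulate _ (π ⟨$⟩ʳ i)) (cong (lookup u) (inverseˡ π))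

lookup-permute-⊕ : ∀ (π : Permutation′ n) u a i →
  lookup (permute π u ⊕ a) (π ⟨$⟩ʳ i) ≡ lookup u i xor lookup a (π ⟨$⟩ʳ i)
lookup-permute-⊕ π u a i = trans (lookup-zipWith _xor_ (π ⟨$⟩ʳ i) (permute π u) a)
  (cong (_xor lookup a (π ⟨$⟩ʳ i)) (lookup-permute π u i))

permute-⊕-injective : ∀ (π : Permutation′ n) a {u v} → permute π u ⊕ a ≡ permute π v ⊕ a → u ≡ v
permute-⊕-injective π a {u} {v} eq = lookup-injective λ i →
  decidable-stable (lookup u i Bool.≟ lookup v i) λ uᵢ≢vᵢ →
    xor-≢ʳ (lookup a (π ⟨$⟩ʳ i)) uᵢ≢vᵢ
      (trans (sym (lookup-permute-⊕ π u a i))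
        (trans (cong (λ w → lookup w (π ⟨$⟩ʳ i)) eq) (lookup-permute-⊕ π v a i)))

-- Equal columns relative to the point 0 leave only a translation to be found, the one taking the
-- image of `v zero` to `w zero`. For vertices it is `a`, for outmap values the flip `z`.
permute-translate : ∀ (π : Permutation′ n) (v w : Fin (suc k) → Bits n) (σ : Fin (suc k) → Fin (suc k))
  (c : Fin n → Fin (suc k) → Bool) →
  (∀ i j → lookup (v j) i ≡ lookup (v zero) i xor c i j) →
  (∀ i j → lookup (w (σ j)) (π ⟨$⟩ʳ i) ≡ lookup (w zero) (π ⟨$⟩ʳ i) xor c i j) →
  ∀ j → permute π (v j) ⊕ (permute π (v zero) ⊕ w zero) ≡ w (σ j)
permute-translate π v w σ c v-col w-col j = lookup-injective λ i →
  subst (λ i → lookup (permute π (v j) ⊕ a) i ≡ lookup (w (σ j)) i) (inverseʳ π) (atπ (π ⟨$⟩ˡ i))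
  where
  a = permute π (v zero) ⊕ w zero

  cancel : ∀ x y z → (x xor y) xor (x xor z) ≡ z xor y
  cancel 𝟎 y z = Bool.xor-comm y z
  cancel 𝟏 y z = trans (Bool.xor-annihilates-not y z) (Bool.xor-comm y z)

  atπ : ∀ i → lookup (permute π (v j) ⊕ a) (π ⟨$⟩ʳ i) ≡ lookup (w (σ j)) (π ⟨$⟩ʳ i)
  atπ i = trans (lookup-permute-⊕ π (v j) a i)
    (trans (cong₂ _xor_ (v-col i j) (lookup-permute-⊕ π (v zero) (w zero) i))
      (trans (cancel (lookup (v zero) i) (c i j) _) (sym (w-col i j))))

enumerates⇒isomorphic : ∀ {r s : PartialOutmap n} {rp rq p q : Fin k → Bits n} →
  Enumerates r rp rq → Enumerates s p q →
  (π : Permutation′ n) (σ : Permutation′ k) (a z : Bits n) →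
  (∀ j → permute π (rp j) ⊕ a ≡ p (σ ⟨$⟩ʳ j)) →
  (∀ j → permute π (rq j) ⊕ z ≡ q (σ ⟨$⟩ʳ j)) →
  IsomorphicUpToFlips r s
enumerates⇒isomorphic {r = r} {s} {rp} {rq} {p} {q} enumʳ enumˢ π σ a z p-eq q-eq = π , a , z , iso
  where
  module R = Enumerates enumʳ
  module S = Enumerates enumˢ

  -- A known image would be listed by `p`; its preimage under `σ` is listed by `rp` and equals `u`
  -- by injectivity.
  unknown : ∀ u → r u ≡ nothing → ∀ y → s (permute π u ⊕ a) ≢ just y
  unknown u ru≡ y su≡ with l , pl≡ ← S.complete su≡
    with refl ← permute-⊕-injective π a {rp (σ ⟨$⟩ˡ l)} {u}
           (trans (p-eq (σ ⟨$⟩ˡ l)) (trans (cong p (inverseʳ σ)) pl≡))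
    with () ← trans (sym ru≡) (R.values (σ ⟨$⟩ˡ l))

  iso : ∀ u → s (permute π u ⊕ a) ≡ Maybe.map (λ x → permute π x ⊕ z) (r u)
  iso u with r u in ru≡
  ... | just x with j , refl ← R.complete ru≡ = trans (cong s (p-eq j))
    (trans (S.values (σ ⟨$⟩ʳ j)) (cong just (trans (sym (q-eq j))
      (cong (λ x → permute π x ⊕ z) (just-injective (trans (sym (R.values j)) ru≡))))))
  ... | nothing with s (permute π u ⊕ a) in su≡
  ...   | nothing = refl
  ...   | just y  = contradiction su≡ (unknown u ru≡ y)

-- Renumbering the points 1, 2, 3 and the dimensions that separate them from 0
-- by τ takes the orientations o to o′.
Renumbers : Permutation′ 3 → (o o′ : Bits 3) → Set
Renumbers τ o o′ = ∀ m j →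
  (lookup (column (τ ⟨$⟩ʳ m) (lookup o (τ ⟨$⟩ʳ m))) (lift₀ τ ⟨$⟩ʳ j) ≡ lookup (column m (lookup o′ m)) j) ×
  (lookup (column (τ ⟨$⟩ʳ m) (not (lookup o (τ ⟨$⟩ʳ m)))) (lift₀ τ ⟨$⟩ʳ j)
     ≡ lookup (column m (not (lookup o′ m))) j)

renumbers? : ∀ τ o o′ → Dec (Renumbers τ o o′)
renumbers? τ o o′ = all? λ m → all? λ j → (_ Bool.≟ _) ×-dec (_ Bool.≟ _)

shape⇒isomorphic : ∀ {r s : PartialOutmap 3} {rp rq p q} o o′ →
  Enumerates r rp rq → Shape rp rq id o′ →
  Enumerates s p q → (ι : Permutation′ 3) → Shape p q (ι ⟨$⟩ʳ_) o →
  (τ : Permutation′ 3) → Renumbers τ o o′ → IsomorphicUpToFlips r s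
shape⇒isomorphic {rp = rp} {rq} {p} {q} o o′ enumʳ shapeʳ enumˢ ι shapeˢ τ renum =
  enumerates⇒isomorphic enumʳ enumˢ π (lift₀ τ) _ _
    (permute-translate π rp p (lift₀ τ ⟨$⟩ʳ_) _ (λ m j → proj₁ (shapeʳ m j)) λ m j →
      trans (proj₁ (shapeˢ (τ ⟨$⟩ʳ m) (lift₀ τ ⟨$⟩ʳ j))) (cong (lookup (p zero) (π ⟨$⟩ʳ m) xor_) (proj₁ (renum m j))))
    (permute-translate π rq q (lift₀ τ ⟨$⟩ʳ_) _ (λ m j → proj₂ (shapeʳ m j)) λ m j →
      trans (proj₂ (shapeˢ (τ ⟨$⟩ʳ m) (lift₀ τ ⟨$⟩ʳ j))) (cong (lookup (q zero) (π ⟨$⟩ʳ m) xor_) (proj₂ (renum m j))))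
  -- Dimension `m` of `r` goes to the dimension of `s` separating 0 from `suc (τ ⟨$⟩ʳ m)`, in step
  -- with the renumbering of points.
  where π = τ ∘ₚ ι

-- Reduction of the eight orientations to two.

orientationᵃ orientationᵇ : Bits 3
orientationᵃ = 𝟏 ∷ 𝟏 ∷ 𝟏 ∷ []
orientationᵇ = 𝟏 ∷ 𝟏 ∷ 𝟎 ∷ []

renumber : ∀ o → (∃ λ τ → Renumbers τ o orientationᵃ) ⊎ (∃ λ τ → Renumbers τ o orientationᵇ)
renumber o@(𝟎 ∷ 𝟎 ∷ 𝟎 ∷ []) = inj₁ (τ , from-yes (renumbers? τ o orientationᵃ))
  where τ = transpose 0F 1F
renumber o@(𝟏 ∷ 𝟏 ∷ 𝟏 ∷ []) = inj₁ (τ , from-yes (renumbers? τ o orientationᵃ))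
  where τ = Perm.id
-- In these six cases `τ` sends `2F` to the position of the bit unlike the other two. It is even if
-- that bit is 𝟎 and a transposition if it is 𝟏, which must be flipped.
renumber o@(𝟏 ∷ 𝟏 ∷ 𝟎 ∷ []) = inj₂ (τ , from-yes (renumbers? τ o orientationᵇ))
  where τ = Perm.id
renumber o@(𝟎 ∷ 𝟏 ∷ 𝟏 ∷ []) = inj₂ (τ , from-yes (renumbers? τ o orientationᵇ))
  where τ = transpose 1F 2F ∘ₚ transpose 0F 1F
renumber o@(𝟏 ∷ 𝟎 ∷ 𝟏 ∷ []) = inj₂ (τ , from-yes (renumbers? τ o orientationᵇ))
  where τ = transpose 0F 1F ∘ₚ transpose 1F 2F
renumber o@(𝟎 ∷ 𝟎 ∷ 𝟏 ∷ []) = inj₂ (τ , from-yes (renumbers? τ o orientationᵇ))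
  where τ = transpose 0F 1F
renumber o@(𝟎 ∷ 𝟏 ∷ 𝟎 ∷ []) = inj₂ (τ , from-yes (renumbers? τ o orientationᵇ))
  where τ = transpose 1F 2F
renumber o@(𝟏 ∷ 𝟎 ∷ 𝟎 ∷ []) = inj₂ (τ , from-yes (renumbers? τ o orientationᵇ))
  where τ = transpose 0F 2F

-- In both lists dimension m separates the points 0 and suc m.
pᵃ qᵃ pᵇ qᵇ : Fin 4 → Bits 3
pᵃ = lookup ((𝟏 ∷ 𝟏 ∷ 𝟏 ∷ []) ∷ (𝟎 ∷ 𝟏 ∷ 𝟎 ∷ []) ∷ (𝟎 ∷ 𝟎 ∷ 𝟏 ∷ []) ∷ (𝟏 ∷ 𝟎 ∷ 𝟎 ∷ []) ∷ [])
qᵃ = lookup ((𝟎 ∷ 𝟎 ∷ 𝟎 ∷ []) ∷ (𝟏 ∷ 𝟏 ∷ 𝟎 ∷ []) ∷ (𝟎 ∷ 𝟏 ∷ 𝟏 ∷ []) ∷ (𝟏 ∷ 𝟎 ∷ 𝟏 ∷ []) ∷ [])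
pᵇ = lookup ((𝟎 ∷ 𝟎 ∷ 𝟎 ∷ []) ∷ (𝟏 ∷ 𝟎 ∷ 𝟎 ∷ []) ∷ (𝟏 ∷ 𝟏 ∷ 𝟏 ∷ []) ∷ (𝟎 ∷ 𝟏 ∷ 𝟏 ∷ []) ∷ [])
qᵇ = lookup ((𝟎 ∷ 𝟏 ∷ 𝟎 ∷ []) ∷ (𝟏 ∷ 𝟎 ∷ 𝟏 ∷ []) ∷ (𝟎 ∷ 𝟎 ∷ 𝟎 ∷ []) ∷ (𝟏 ∷ 𝟏 ∷ 𝟏 ∷ []) ∷ [])

shape? : ∀ p q o → Dec (Shape p q id o)
shape? p q o = all? λ m → all? λ j → (_ Bool.≟ _) ×-dec (_ Bool.≟ _)

enumeratesᵃ : Enumerates sᵃ pᵃ qᵃ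
enumeratesᵃ = record
  { values   = λ { 0F → refl ; 1F → refl ; 2F → refl ; 3F → refl }
  ; complete = complete
  }
  where
  complete : ∀ {u x} → sᵃ u ≡ just x → ∃ λ j → pᵃ j ≡ u
  complete {𝟏 ∷ 𝟏 ∷ 𝟏 ∷ []} _ = 0F , refl
  complete {𝟎 ∷ 𝟏 ∷ 𝟎 ∷ []} _ = 1F , refl
  complete {𝟎 ∷ 𝟎 ∷ 𝟏 ∷ []} _ = 2F , refl
  complete {𝟏 ∷ 𝟎 ∷ 𝟎 ∷ []} _ = 3F , refl
  complete {𝟎 ∷ 𝟎 ∷ 𝟎 ∷ []} ()
  complete {𝟎 ∷ 𝟏 ∷ 𝟏 ∷ []} ()
  complete {𝟏 ∷ 𝟎 ∷ 𝟏 ∷ []} ()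
  complete {𝟏 ∷ 𝟏 ∷ 𝟎 ∷ []} ()

enumeratesᵇ : Enumerates sᵇ pᵇ qᵇ
enumeratesᵇ = record
  { values   = λ { 0F → refl ; 1F → refl ; 2F → refl ; 3F → refl }
  ; complete = complete
  }
  where
  complete : ∀ {u x} → sᵇ u ≡ just x → ∃ λ j → pᵇ j ≡ u
  complete {𝟎 ∷ 𝟎 ∷ 𝟎 ∷ []} _ = 0F , refl
  complete {𝟏 ∷ 𝟎 ∷ 𝟎 ∷ []} _ = 1F , refl
  complete {𝟏 ∷ 𝟏 ∷ 𝟏 ∷ []} _ = 2F , refl
  complete {𝟎 ∷ 𝟏 ∷ 𝟏 ∷ []} _ = 3F , refl
  complete {𝟎 ∷ 𝟎 ∷ 𝟏 ∷ []} ()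
  complete {𝟎 ∷ 𝟏 ∷ 𝟎 ∷ []} ()
  complete {𝟏 ∷ 𝟎 ∷ 𝟏 ∷ []} ()
  complete {𝟏 ∷ 𝟏 ∷ 𝟎 ∷ []} ()

-- The four points of a certificate.

is-just⇒≡just : {A : Set} {m : Maybe A} → Is-just m → ∃ λ x → m ≡ just x
is-just⇒≡just (just {x} _) = x , refl

is-just-irrelevant : {A : Set} {m : Maybe A} (x y : Is-just m) → x ≡ y
is-just-irrelevant (just _) (just _) = refl

module Certificate {s : PartialOutmap n} (cert : IsCertificate 4 s) where

  open IsCertificate cert

  point value : Fin 4 → Bits n
  point j = proj₁ (Inverse.to size j)
  value j = proj₁ (is-just⇒≡just (proj₂ (Inverse.to size j)))

  s-point : ∀ j → s (point j) ≡ just (value j)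
  s-point j = proj₂ (is-just⇒≡just (proj₂ (Inverse.to size j)))

  enumerates : Enumerates s point value
  enumerates = record
    { values   = s-point
    ; complete = λ {u} su≡ →
        let known = subst Is-just (sym su≡) (just _) in
        Inverse.from size (u , known) , cong proj₁ (Inverse.strictlyInverseˡ size (u , known))
    }

  open Enumerates enumerates using (complete)

  value-unique : ∀ {j x} → s (point j) ≡ just x → value j ≡ x
  value-unique {j} su≡ = just-injective (trans (sym (s-point j)) su≡)

  point-injective : ∀ {j l} → point j ≡ point l → j ≡ l
  point-injective = Injection.injective (↔⇒↣ size) ∘ known-≡
    where
    known-≡ : {a b : ∃ (Known s)} → proj₁ a ≡ proj₁ b → a ≡ b
    known-≡ {u , x} {.u , y} refl = cong (u ,_) (is-just-irrelevant x y)

  ¬extendable : ¬ Extendable U point value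
  ¬extendable (t , sw , extends) = nonCompletable (t , szaboWelzl⇒isUSO sw , λ u x su≡ →
    let j , pⱼ≡u = complete su≡ in
    trans (cong t (sym pⱼ≡u)) (trans (extends _) (value-unique (trans (cong s pⱼ≡u) su≡))))

  -- Two of the four points form a proper subset, so by minimality some USO has their values, and it
  -- separates them.
  pairwiseSep : PairwiseSep U point value
  pairwiseSep {j} {l} _ _ j≢l =
    let t , uso , agrees = minimal P (P⊆known , known⊈P) in
    subst₂ (Separated (point j) (point l))
      (agrees (point j) (value j) (restricted j (inj₁ refl)))
      (agrees (point l) (value l) (restricted l (inj₂ refl)))
      (isUSO⇒szaboWelzl uso (point j) (point l) (j≢l ∘ point-injective))
    where
    P? : ∀ u → Dec (u ≡ point j ⊎ u ≡ point l)
    P? u = (u ≟ᵛ point j) ⊎-dec (u ≟ᵛ point l)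

    P : Bits n → Bool
    P u = ⌊ P? u ⌋

    P⊆known : T ∘ P ⊆ Known s
    P⊆known {u} Pu with toWitness {a? = P? u} Pu
    ... | inj₁ refl = proj₂ (Inverse.to size j)
    ... | inj₂ refl = proj₂ (Inverse.to size l)

    third : ∀ (j l : Fin 4) → ∃ λ m → m ≢ j × m ≢ l
    third = from-yes (all? λ (j : Fin 4) → all? λ (l : Fin 4) → any? λ m →
      ¬? (m Fin.≟ j) ×-dec ¬? (m Fin.≟ l))

    known⊈P : ¬ (Known s ⊆ T ∘ P)
    known⊈P known⊆P with m , m≢j , m≢l ← third j l
      with toWitness {a? = P? (point m)} (known⊆P (proj₂ (Inverse.to size m)))
    ... | inj₁ pₘ≡pⱼ = m≢j (point-injective pₘ≡pⱼ)
    ... | inj₂ pₘ≡pₗ = m≢l (point-injective pₘ≡pₗ)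

    restricted : ∀ m → point m ≡ point j ⊎ point m ≡ point l →
                 restrict s P (point m) ≡ just (value m)
    restricted m Pm with P? (point m)
    ... | yes _  = s-point m
    ... | no ¬Pm = contradiction Pm ¬Pm

  point-takes : (∀ i → Spanned s i) → ∀ i b → ∃ λ j → lookup (point j) i ≡ b
  point-takes spanned i b with spanned i
  ... | u , v , known-u , known-v , uᵢ≢vᵢ
    with j , refl ← complete (proj₂ (is-just⇒≡just known-u))
       | l , refl ← complete (proj₂ (is-just⇒≡just known-v))
    with lookup (point j) i Bool.≟ b
  ...   | yes pⱼ≡b = j , pⱼ≡b
  ...   | no pⱼ≢b  = l , ≢-≢⇒≡ (uᵢ≢vᵢ ∘ sym) pⱼ≢b

  value-takes : (∀ i → ¬ Projectable s i) → ∀ i b → ∃ λ j → lookup (value j) i ≡ b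
  value-takes ¬projectable i b with any? (λ j → lookup (value j) i Bool.≟ b)
  ... | yes takes = takes
  ... | no ¬takes = contradiction projectable (¬projectable i)
    where
    projectable : Projectable s i
    projectable u v x y su≡ sv≡ with j , refl ← complete su≡ | l , refl ← complete sv≡
      with refl ← value-unique su≡ | refl ← value-unique sv≡ =
      ≢-≢⇒≡ (λ eq → ¬takes (j , eq)) (λ eq → ¬takes (l , sym eq))

-- The classification.

shape⇒classified : ∀ {s : PartialOutmap n} {p q} → Enumerates s p q →
  (ι : Permutation 3 n) → ∀ o → Shape p q (ι ⟨$⟩ʳ_) o →
  Σ[ n≡3 ∈ n ≡ 3 ]
    (IsomorphicUpToFlips sᵃ (subst PartialOutmap n≡3 s) ⊎
     IsomorphicUpToFlips sᵇ (subst PartialOutmap n≡3 s))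
-- The bijection `ι` forces `n` to be 3; matching on `refl` removes the `subst`.
shape⇒classified enum ι o shape with refl ← ↔⇒≡ ι = refl , Sum.map
  (λ (τ , renum) → shape⇒isomorphic o orientationᵃ enumeratesᵃ shapeᵃ enum ι shape τ renum)
  (λ (τ , renum) → shape⇒isomorphic o orientationᵇ enumeratesᵇ shapeᵇ enum ι shape τ renum)
  (renumber o)
  where
  shapeᵃ = from-yes (shape? pᵃ qᵃ orientationᵃ)
  shapeᵇ = from-yes (shape? pᵇ qᵇ orientationᵇ)

theorem61 : ∀ (n : ℕ) (s : PartialOutmap n) →
    IsCertificate 4 s →
    (∀ i → ¬ Projectable s i) →
    (∀ i → Spanned s i) →
    Σ[ n≡3 ∈ n ≡ 3 ]
    (IsomorphicUpToFlips sᵃ (subst PartialOutmap n≡3 s) ⊎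
    IsomorphicUpToFlips sᵇ (subst PartialOutmap n≡3 s))
-- Without dimensions nothing can separate two points.
theorem61 zero s cert _ _ with () ← proj₁ (Certificate.pairwiseSep cert {0F} {1F} _ _ (λ ()))
theorem61 (suc n) s cert ¬projectable spanned = shape⇒classified enumerates dimensions orientation shape
  where
  open Certificate cert
  open FourPoints point value pairwiseSep ¬extendable (point-takes spanned) (value-takes ¬projectable)

  columnsOf : ∀ m → ∃ (Columns (λ j → lookup (point j) (separatingDim m))
                               (λ j → lookup (value j) (separatingDim m)) m)
  columnsOf m = columns _ _ (λ p≡ q≡ → class-injective (separatingDim m) (cong₂ _,_ p≡ q≡))
    m (proj₁ (sepAt-separatingDim m)) (proj₂ (sepAt-separatingDim m))

  orientation : Bits 3
  orientation = tabulate (proj₁ ∘ columnsOf)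

  shape : Shape point value separatingDim orientation
  shape m = subst (Columns _ _ m) (sym (lookup∘tabulate (proj₁ ∘ columnsOf) m)) (proj₂ (columnsOf m))
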